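{- Let $n$ be a positive integer and let $K_{n,n}$ have color classes $U$ and $V$, where $U=U_1\uplus U_2\uplus U_3$ and $V=V_1\uplus V_2\uplus V_3$ are partitions with $|U_i|=|V_i|\ge\lfloor n/3\rfloor$ for $i=1,2,3$. Let $D$ be a bipartite demand graph on $U\cup V$ whose every edge joins a vertex of $U$ to a vertex of $V$. Suppose $\Delta(D)\le\lfloor n/3\rfloor$ and that for all $i\ne j$ no edge of $D$ joins a vertex of $U_i$ to a vertex of $V_j$. Then $D$ is resolvable in $K_{n,n}$.
   Context: A demand graph on the vertex set of a simple base graph $G$ is a loopless multigraph $D$ with $V(D)=V(G)$ (parallel edges allowed). $D$ is resolvable in $G$ if one can assign to each edge of $D$ (counted with multiplicity) a path in $G$ joining the two endpoints of that edge, such that the assigned paths are pairwise edge-disjoint. $\Delta(D)$ is the maximum degree of $D$, counting edges with multiplicity; $\uplus$ denotes disjoint union. -}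

module Defs where

open import Data.Nat using (ℕ; _≤_)
open import Data.Fin using (Fin; _≟_)
open import Data.List using (List; []; _∷_; length; filter; lookup; allFin)
open import Data.List.Relation.Unary.Unique.Propositional using (Unique)
open import Data.Product using (_×_; _,_; proj₁; proj₂; Σ)
open import Data.Sum using (_⊎_; inj₁; inj₂)
open import Data.Unit using (⊤)
open import Data.Empty using (⊥)
open import Relation.Binary.PropositionalEquality using (_≡_; _≢_)
open import Relation.Nullary using (¬_)

-- A simple graph: vertex type with a (symmetric, irreflexive) adjacency relation.
record Graph : Set₁ where
  field
    Vert : Set
    Adj  : Vert → Vert → Set
open Graph public

data Walk (G : Graph) : Vert G → Vert G → Set where
  stop : (a : Vert G) → Walk G a a
  step : {a b c : Vert G} → Adj G a b → Walk G b c → Walk G a c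

verts : {G : Graph} {a b : Vert G} → Walk G a b → List (Vert G)
verts (stop a) = a ∷ []
verts (step {a = a} _ w) = a ∷ verts w

record Path (G : Graph) (a b : Vert G) : Set where
  field
    walk : Walk G a b
    distinct : Unique (verts walk)
open Path public

data Traverses {G : Graph} : {a b : Vert G} → Walk G a b → Vert G → Vert G → Set where
  here  : {a b c : Vert G} (e : Adj G a b) (w : Walk G b c) → Traverses (step e w) a b
  there : {a b c x y : Vert G} (e : Adj G a b) {w : Walk G b c} →
          Traverses w x y → Traverses (step e w) x y

UsesEdge : {G : Graph} {a b : Vert G} → Path G a b → Vert G → Vert G → Set
UsesEdge p x y = Traverses (walk p) x y ⊎ Traverses (walk p) y x

-- Demand graphs (loopless multigraphs) given as a list of edges; parallel
-- edges are repeated list entries, each list position is one edge.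
-- D is resolvable in G if each edge gets a path joining its ends, pairwise edge-disjoint.
Resolvable : (G : Graph) → List (Vert G × Vert G) → Set
Resolvable G D =
  Σ ((i : Fin (length D)) → Path G (proj₁ (lookup D i)) (proj₂ (lookup D i))) λ f →
    ∀ (i j : Fin (length D)) → i ≢ j → ∀ (x y : Vert G) →
      UsesEdge (f i) x y → ¬ UsesEdge (f j) x y

-- Complete bipartite graph K_{n,n}: U = inj₁ (Fin n), V = inj₂ (Fin n).
KAdj : (n : ℕ) → Fin n ⊎ Fin n → Fin n ⊎ Fin n → Set
KAdj n (inj₁ _) (inj₂ _) = ⊤
KAdj n (inj₂ _) (inj₁ _) = ⊤
KAdj n _ _ = ⊥

K : ℕ → Graph
K n = record { Vert = Fin n ⊎ Fin n ; Adj = KAdj n }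

-- Bipartite demand graph given by its list of edges (u , v) with u ∈ U, v ∈ V.
embed : {n : ℕ} → Fin n × Fin n → (Fin n ⊎ Fin n) × (Fin n ⊎ Fin n)
embed (u , v) = inj₁ u , inj₂ v

embedAll : {n : ℕ} → List (Fin n × Fin n) → List ((Fin n ⊎ Fin n) × (Fin n ⊎ Fin n))
embedAll [] = []
embedAll (e ∷ es) = embed e ∷ embedAll es

degU : {n : ℕ} → List (Fin n × Fin n) → Fin n → ℕ
degU D u = length (filter (λ e → proj₁ e ≟ u) D)

degV : {n : ℕ} → List (Fin n × Fin n) → Fin n → ℕ
degV D v = length (filter (λ e → proj₂ e ≟ v) D)

MaxDegLe : {n : ℕ} → List (Fin n × Fin n) → ℕ → Set
MaxDegLe D k = (∀ u → degU D u ≤ k) × (∀ v → degV D v ≤ k)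

classSize : {n : ℕ} → (Fin n → Fin 3) → Fin 3 → ℕ
classSize {n} p i = length (filter (λ u → p u ≟ i) (allFin n))

{-# OPTIONS --safe #-}
-- Put k = ⌊n/3⌋ and let A, B, C be the classes in cyclic order. By König's theorem the demands have
-- a proper edge colouring with k colours. A demand uv of class i is routed as
-- u – y – x – v through the next class j, where y ∈ V_j is indexed by the colour γ and x ∈ U_j by the
-- index of v shifted by γ. Around the cycle each of the nine blocks U_i × V_j then serves one
-- purpose, and within it an edge determines γ together with u or v, hence the demand. This
-- works whenever the next class is not smaller. As the sizes are k plus excesses summing to at
-- most 2, at most one step of the cycle (from A to B) goes down, and the demands that do not
-- fit there are routed over edges left unused by the others.
module Submission where

open import Defs
open import Data.Bool using (Bool; true; false; not; if_then_else_)
open import Data.Bool.Properties using (not-¬; not-involutive)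
open import Data.Empty using (⊥-elim)
open import Data.Fin using (Fin; zero; suc; toℕ; fromℕ<; inject≤)
open import Data.Fin.Properties
  using (<⇒notInjective; injective⇒≤; inject≤-injective; any?; ¬∀⟶∃¬; toℕ<n; toℕ-fromℕ<;
         toℕ-injective; suc-injective)
  renaming (_≟_ to _≟F_)
open import Data.List using (List; []; _∷_; length; filter; lookup; allFin; map; cartesianProduct)
open import Data.List.Membership.Propositional using (_∈_; find; lose)
open import Data.List.Membership.Propositional.Properties
  using (∈-filter⁺; ∈-filter⁻; ∈-allFin; ∈-lookup; ∈-cartesianProduct⁺)
open import Data.List.Properties
  using (length-filter; length-tabulate; map-tabulate; tabulate-lookup)
open import Data.List.Relation.Unary.All as All using ([]; _∷_)
open import Data.List.Relation.Unary.AllPairs using ([]; _∷_)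
open import Data.List.Relation.Unary.Any as Any using (here; there; index)
open import Data.List.Relation.Unary.Any.Properties using (lookup-index)
open import Data.List.Relation.Unary.Unique.Propositional using (Unique)
open import Data.List.Relation.Unary.Unique.Propositional.Properties using (allFin⁺; filter⁺)
open import Data.Nat using (ℕ; zero; suc; _+_; _*_; _∸_; _/_; pred; _≤_; _<_; z≤n; s≤s; _≤?_; _<?_)
open import Data.Nat.DivMod using (m≡m%n+[m/n]*n; m%n<n)
open import Data.Nat.Properties
  using (+-assoc; +-cancelʳ-<; +-cancelʳ-≡; +-cancelʳ-≤; +-cancelˡ-<; +-comm; +-identityʳ; +-mono-<;
         +-monoʳ-≤; +-monoˡ-<; +-suc; <-irrefl; <-≤-trans; <⇒≢; <⇒≤; <⇒≱; m+[n∸m]≡n; m<n⇒m<1+n;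
         m∸n+n≡m; m∸n≤m; m≤m+n; m≤n+m; n<1+n; ∸-cancelʳ-≡; ≤-<-trans; ≤-antisym; ≤-pred; ≤-refl;
         ≤-reflexive; ≤-trans; ≤∧≢⇒<; ≮⇒≥; ≰⇒>)
  renaming (_≟_ to _≟ℕ_)
open import Data.Nat.Tactic.RingSolver using (solve-∀)
open import Data.Product using (Σ; ∃; _×_; _,_; proj₁; proj₂)
open import Data.Product.Properties using (≡-dec)
open import Data.Sum using (_⊎_; inj₁; inj₂)
open import Data.Sum.Properties using (inj₁-injective; inj₂-injective)
open import Data.Unit using (tt)
open import Function using (_∘_; id)
open import Relation.Binary.Definitions using (DecidableEquality)
open import Relation.Binary.PropositionalEquality
  using (_≡_; _≢_; refl; sym; trans; cong; cong₂; subst; subst₂)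
open import Relation.Nullary using (¬_; Dec; yes; no; contradiction; does)
open import Relation.Nullary.Decidable using (¬?; _×-dec_; _⊎-dec_; map′; dec-true; dec-false)
open import Relation.Unary using (Decidable)

-- The vertex `x` has to depend on both the colour and `v`. Chosen by the colour alone, it would
-- make all demands of one class and colour share the middle edge; chosen by `v` alone, it would
-- make all demands ending at `v` share the last one. Subtraction in a cyclic group serves both: any
-- two of v, γ and v - γ determine the third, so the middle edge, which shows γ and v - γ, gives v,
-- and the last edge, which shows v and v - γ, gives γ. The obstacle is a step down in size, where
-- some residues have no vertex in the next class. The same mismatch supplies the spare edges: there
-- are only k colours, so where a class has more than k vertices some ranks or differences of ranks
-- belong to no colour. With one large class this is not quite enough. Some A-demands must use edges
-- inside the A-block, and which ones depends on the demand graph, so no fixed shift of the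
-- C-demands can be relied on to avoid them. For the C-demands the shift is therefore replaced by a
-- Latin array with forbidden entries, obtained from a second use of edge colouring.

-- Edge colourings of bipartite multigraphs

module EdgeColouring {E : Set} (_≟_ : DecidableEquality E) where

  -- A side of the multigraph is a labelling of its edges by their ends on that side; parallel edges
  -- are different elements of `E` with equal labels.
  Proper : {L C : Set} → (E → L) → (E → C) → List E → Set
  Proper f c xs = ∀ {x y} → x ∈ xs → y ∈ xs → f x ≡ f y → c x ≡ c y → x ≡ y

  AtMostTwo : {L : Set} → (E → L) → List E → Set
  AtMostTwo f xs = ∀ {x y z} → x ∈ xs → y ∈ xs → z ∈ xs → f x ≡ f y → f x ≡ f z →
                   x ≡ y ⊎ x ≡ z ⊎ y ≡ z

  -- Phrased by injective families instead of lengths, so that repeated list entries count once and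
  -- passing to fewer edges needs no counting.
  AtMost : {L : Set} → ℕ → (E → L) → List E → Set
  AtMost k f xs = (g : Fin (suc k) → E) → (∀ i → g i ∈ xs) → (∀ {i j} → g i ≡ g j → i ≡ j) →
                  ¬ (∀ i j → f (g i) ≡ f (g j))

  without : E → List E → List E
  without e = filter (λ x → ¬? (x ≟ e))

  ∈-without⁺ : ∀ {e x ys} → x ∈ ys → x ≢ e → x ∈ without e ys
  ∈-without⁺ {e} = ∈-filter⁺ (λ x → ¬? (x ≟ e))

  ∈-without⁻ : ∀ {e x} ys → x ∈ without e ys → x ∈ ys × x ≢ e
  ∈-without⁻ {e} ys = ∈-filter⁻ (λ x → ¬? (x ≟ e)) {xs = ys}

  ∈-split : ∀ {e x ys} → x ∈ e ∷ ys → x ∈ e ∷ without e ys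
  ∈-split {e} {x} x∈ with x ≟ e
  ... | yes refl = here refl
  ∈-split (here refl) | no x≢e = contradiction refl x≢e
  ∈-split (there x∈) | no x≢e = there (∈-without⁺ x∈ x≢e)

  search : {P : E → Set} → Decidable P → ∀ xs → Dec (∃ λ x → x ∈ xs × P x)
  search P? xs = map′ find (λ (_ , x∈ , px) → lose x∈ px) (Any.any? P? xs)

  extend : {C : Set} → (E → C) → E → C → E → C
  extend c e b x = if does (x ≟ e) then b else c x

  extend-self : {C : Set} (c : E → C) (e : E) (b : C) → extend c e b e ≡ b
  extend-self c e b with e ≟ e
  ... | yes _ = refl
  ... | no e≢e = contradiction refl e≢e

  extend-other : {C : Set} (c : E → C) {e x : E} (b : C) → x ≢ e → extend c e b x ≡ c x
  extend-other c {e} {x} b x≢e with x ≟ e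
  ... | yes x≡e = contradiction x≡e x≢e
  ... | no _ = refl

  extend-proper : {L C : Set} (f : E → L) (c : E → C) {e : E} (b : C) {zs : List E} →
                  (∀ {x} → x ∈ zs → x ≢ e) → Proper f c zs →
                  (∀ {x} → x ∈ zs → f x ≡ f e → c x ≢ b) →
                  Proper f (extend c e b) (e ∷ zs)
  extend-proper f c b fresh prop free (here refl) (here refl) _ _ = refl
  extend-proper f c {e} b fresh prop free (here refl) (there y∈) eqf eqc =
    contradiction (trans (sym (extend-other c b (fresh y∈))) (trans (sym eqc) (extend-self c e b)))
                  (free y∈ (sym eqf))
  extend-proper f c {e} b fresh prop free (there x∈) (here refl) eqf eqc =
    contradiction (trans (sym (extend-other c b (fresh x∈))) (trans eqc (extend-self c e b)))
                  (free x∈ eqf)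
  extend-proper f c b fresh prop free (there x∈) (there y∈) eqf eqc =
    prop x∈ y∈ eqf (trans (sym (extend-other c b (fresh x∈))) (trans eqc (extend-other c b (fresh y∈))))

  proper-⊆ : {L C : Set} {f : E → L} {c : E → C} {xs ys : List E} →
             (∀ {x} → x ∈ xs → x ∈ ys) → Proper f c ys → Proper f c xs
  proper-⊆ sub prop x∈ y∈ = prop (sub x∈) (sub y∈)

  atMostTwo-⊆ : {L : Set} {f : E → L} {xs ys : List E} →
                (∀ {x} → x ∈ xs → x ∈ ys) → AtMostTwo f ys → AtMostTwo f xs
  atMostTwo-⊆ sub two x∈ y∈ z∈ = two (sub x∈) (sub y∈) (sub z∈)

  -- The edge `e`, absent from `zs`, takes one of the two places at its vertex and leaves only one.
  atMostTwo-twin : {L : Set} {f : E → L} {e : E} {ys zs : List E} → AtMostTwo f ys →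
                   e ∈ ys → (∀ {x} → x ∈ zs → x ∈ ys) → (∀ {x} → x ∈ zs → x ≢ e) →
                   ∀ {x y} → x ∈ zs → y ∈ zs → f x ≡ f e → f y ≡ f e → x ≡ y
  atMostTwo-twin two e∈ sub fresh x∈ y∈ fx fy
    with two e∈ (sub x∈) (sub y∈) (sym fx) (sym fy)
  ... | inj₁ e≡x = contradiction (sym e≡x) (fresh x∈)
  ... | inj₂ (inj₁ e≡y) = contradiction (sym e≡y) (fresh y∈)
  ... | inj₂ (inj₂ x≡y) = x≡y

  module Merge {T : Set} (_≟T_ : DecidableEquality T) (t : E → T) (e e₂ : E) where

    merge : E → T
    merge x = if does (t x ≟T t e₂) then t e else t x

    merge-cong : ∀ {x y} → t x ≡ t y → merge x ≡ merge y
    merge-cong {x} {y} eq rewrite eq = refl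

    merge-to : ∀ {x} → t x ≡ t e₂ → merge x ≡ t e
    merge-to {x} eq with t x ≟T t e₂
    ... | yes _ = refl
    ... | no ¬eq = contradiction eq ¬eq

    merge-id : ∀ {x} → t x ≡ t e → merge x ≡ t e
    merge-id {x} eq with t x ≟T t e₂
    ... | yes _ = refl
    ... | no _ = eq

    -- Once `e` and `e₂` are removed, their ends keep at most one edge each, so the merged vertex
    -- has at most two.
    merge-atMostTwo : ∀ {ys zs} → AtMostTwo t ys → e ∈ ys → e₂ ∈ ys →
                      (∀ {x} → x ∈ zs → x ∈ ys) → (∀ {x} → x ∈ zs → x ≢ e) → (∀ {x} → x ∈ zs → x ≢ e₂) →
                      AtMostTwo merge zs
    merge-atMostTwo {ys} {zs} two e∈ e₂∈ sub fresh fresh₂ {x} {y} {z} x∈ y∈ z∈ xy xz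
      with t x ≟T t e₂ | t y ≟T t e₂ | t z ≟T t e₂
    ... | yes p | yes q | _ = inj₁ (atMostTwo-twin two e₂∈ sub fresh₂ x∈ y∈ p q)
    ... | yes p | no _ | yes r = inj₂ (inj₁ (atMostTwo-twin two e₂∈ sub fresh₂ x∈ z∈ p r))
    ... | yes p | no _ | no _ = inj₂ (inj₂ (atMostTwo-twin two e∈ sub fresh y∈ z∈ (sym xy) (sym xz)))
    ... | no _ | yes q | yes r = inj₂ (inj₂ (atMostTwo-twin two e₂∈ sub fresh₂ y∈ z∈ q r))
    ... | no _ | yes q | no _ = inj₂ (inj₁ (atMostTwo-twin two e∈ sub fresh x∈ z∈ xy (trans (sym xz) xy)))
    ... | no _ | no _ | yes r = inj₁ (atMostTwo-twin two e∈ sub fresh x∈ y∈ xz (trans (sym xy) xz))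
    ... | no _ | no _ | no _ = two (sub x∈) (sub y∈) (sub z∈) xy xz

  -- Two edges e, e₂ at a common vertex of the first side are contracted: their other ends are
  -- merged, which keeps all degrees at most two, and a colouring of the rest lifts back.
  twoColouring : {S T : Set} → DecidableEquality S → DecidableEquality T →
                 ∀ n xs → length xs ≤ n → (s : E → S) (t : E → T) → AtMostTwo s xs → AtMostTwo t xs →
                 Σ (E → Bool) λ c → Proper s c xs × Proper t c xs
  twoColouring _ _ n [] _ s t _ _ = (λ _ → true) , (λ ()) , (λ ())
  twoColouring _≟S_ _≟T_ (suc n) (e ∷ ys) (s≤s len) s t twoS twoT
    with search (λ x → s x ≟S s e) (without e ys)
  ... | no ¬mate = lift
    where
    zs = without e ys
    fresh : ∀ {x} → x ∈ zs → x ≢ e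
    fresh = proj₂ ∘ ∈-without⁻ ys
    sub : ∀ {x} → x ∈ zs → x ∈ e ∷ ys
    sub = there ∘ proj₁ ∘ ∈-without⁻ ys
    ih = twoColouring _≟S_ _≟T_ n zs (≤-trans (length-filter _ ys) len) s t
                      (atMostTwo-⊆ sub twoS) (atMostTwo-⊆ sub twoT)
    c = proj₁ ih
    free : ∃ λ b → ∀ {x} → x ∈ zs → t x ≡ t e → c x ≢ b
    free with search (λ x → t x ≟T t e) zs
    ... | no ¬f = true , λ x∈ eq _ → ¬f (_ , x∈ , eq)
    ... | yes (f , f∈ , tf) = not (c f) , λ x∈ tx cx →
      not-¬ (cong c (atMostTwo-twin twoT (here refl) sub fresh x∈ f∈ tx tf)) cx
    lift : Σ (E → Bool) λ c → Proper s c (e ∷ ys) × Proper t c (e ∷ ys)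
    lift = extend c e (proj₁ free) ,
      proper-⊆ ∈-split (extend-proper s c _ fresh (proj₁ (proj₂ ih)) (λ x∈ sx _ → ¬mate (_ , x∈ , sx))) ,
      proper-⊆ ∈-split (extend-proper t c _ fresh (proj₂ (proj₂ ih)) (proj₂ free))
  ... | yes (e₂ , e₂∈ , se₂) = lift
    where
    open Merge _≟T_ t e e₂
    ws = without e ys
    zs = without e₂ ws
    fresh : ∀ {x} → x ∈ ws → x ≢ e
    fresh = proj₂ ∘ ∈-without⁻ ys
    sub : ∀ {x} → x ∈ ws → x ∈ e ∷ ys
    sub = there ∘ proj₁ ∘ ∈-without⁻ ys
    fresh₂ : ∀ {x} → x ∈ zs → x ≢ e₂
    fresh₂ = proj₂ ∘ ∈-without⁻ ws
    z⇒w : ∀ {x} → x ∈ zs → x ∈ ws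
    z⇒w = proj₁ ∘ ∈-without⁻ ws
    noS : ∀ {x} → x ∈ zs → s x ≢ s e
    noS x∈ sx = fresh₂ x∈ (atMostTwo-twin twoS (here refl) sub fresh (z⇒w x∈) e₂∈ sx se₂)
    ih = twoColouring _≟S_ _≟T_ n zs (≤-trans (length-filter _ ws) (≤-trans (length-filter _ ys) len)) s merge
                      (atMostTwo-⊆ (sub ∘ z⇒w) twoS)
                      (merge-atMostTwo twoT (here refl) (sub e₂∈) (sub ∘ z⇒w) (fresh ∘ z⇒w) fresh₂)
    c = proj₁ ih
    free : ∃ λ b → (∀ {x} → x ∈ zs → t x ≡ t e → c x ≢ b) × (∀ {x} → x ∈ zs → t x ≡ t e₂ → c x ≢ not b)
    free with search (λ x → t x ≟T t e) zs | search (λ x → t x ≟T t e₂) zs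
    ... | no ¬f | no ¬f₂ = true , (λ x∈ eq _ → ¬f (_ , x∈ , eq)) , (λ x∈ eq _ → ¬f₂ (_ , x∈ , eq))
    ... | no ¬f | yes (f₂ , f₂∈ , tf₂) = c f₂ , (λ x∈ eq _ → ¬f (_ , x∈ , eq)) , λ x∈ tx cx →
      not-¬ (cong c (atMostTwo-twin twoT (sub e₂∈) (sub ∘ z⇒w) fresh₂ x∈ f₂∈ tx tf₂)) cx
    -- `f` and any `x` at the end of `e₂` meet at the merged vertex. Equal colours would make them
    -- one edge, and then it, `e` and `e₂` would be three edges at one vertex.
    ... | yes (f , f∈ , tf) | _ = not (c f) ,
      (λ x∈ tx cx → not-¬ (cong c (atMostTwo-twin twoT (here refl) sub fresh (z⇒w x∈) (z⇒w f∈) tx tf)) cx) ,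
      λ {x} x∈ tx cx →
        let x≡f = proj₂ (proj₂ ih) x∈ f∈ (trans (merge-to tx) (sym (merge-id tf))) (trans cx (not-involutive (c f)))
            te₂ = trans (sym tx) (trans (cong t x≡f) tf)
        in fresh₂ f∈ (atMostTwo-twin twoT (here refl) sub fresh (z⇒w f∈) e₂∈ tf te₂)
    b = proj₁ free
    c₂ = extend c e₂ (not b)
    fresh′ : ∀ {x} → x ∈ e₂ ∷ zs → x ≢ e
    fresh′ (here refl) = fresh e₂∈
    fresh′ (there x∈) = fresh (z⇒w x∈)
    split : ∀ {x} → x ∈ e ∷ ys → x ∈ e ∷ e₂ ∷ zs
    split x∈ with ∈-split x∈
    ... | here eq = here eq
    ... | there x∈ws = there (∈-split (there x∈ws))
    c₂e₂≢b : c₂ e₂ ≢ b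
    c₂e₂≢b eq = not-¬ {b} {b} refl (trans (sym eq) (extend-self c e₂ (not b)))
    lift : Σ (E → Bool) λ c → Proper s c (e ∷ ys) × Proper t c (e ∷ ys)
    lift = extend c₂ e b ,
      proper-⊆ split (extend-proper s c₂ b fresh′
        (extend-proper s c (not b) fresh₂ (proj₁ (proj₂ ih)) (λ x∈ sx _ → noS x∈ (trans sx se₂)))
        (λ { (here refl) _ → c₂e₂≢b ; (there x∈) sx _ → noS x∈ sx })) ,
      proper-⊆ split (extend-proper t c₂ b fresh′
        (extend-proper t c (not b) fresh₂ (λ x∈ y∈ tx → proj₂ (proj₂ ih) x∈ y∈ (merge-cong tx)) (proj₂ (proj₂ free)))
        (λ { (here refl) _ → c₂e₂≢b
           ; (there x∈) tx cx → proj₁ (proj₂ free) x∈ tx (trans (sym (extend-other c (not b) (fresh₂ x∈))) cx) }))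

  -- Otherwise every colour occurs on an edge at the end of `e`, and these k edges together with `e`
  -- exceed the degree bound.
  free-colour : {L : Set} → DecidableEquality L → ∀ k (f : E → L) (c : E → Fin k) {e zs} →
                (∀ {x} → x ∈ zs → x ≢ e) → AtMost k f (e ∷ zs) →
                ∃ λ α → ∀ {x} → x ∈ zs → f x ≡ f e → c x ≢ α
  free-colour _≟L_ k f c {e} {zs} fresh deg
    with ¬∀⟶∃¬ k (λ α → ∃ λ x → x ∈ zs × (f x ≡ f e × c x ≡ α))
               (λ α → search (λ x → (f x ≟L f e) ×-dec (c x ≟F α)) zs) ¬all
    where
    ¬all : ¬ (∀ α → ∃ λ x → x ∈ zs × (f x ≡ f e × c x ≡ α))
    ¬all all = deg g g∈ g-inj (λ i j → trans (fg i) (sym (fg j)))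
      where
      g : Fin (suc k) → E
      g zero = e
      g (suc α) = proj₁ (all α)
      g∈ : ∀ i → g i ∈ e ∷ zs
      g∈ zero = here refl
      g∈ (suc α) = there (proj₁ (proj₂ (all α)))
      fg : ∀ i → f (g i) ≡ f e
      fg zero = refl
      fg (suc α) = proj₁ (proj₂ (proj₂ (all α)))
      cg : ∀ α → c (g (suc α)) ≡ α
      cg α = proj₂ (proj₂ (proj₂ (all α)))
      g-inj : ∀ {i j} → g i ≡ g j → i ≡ j
      g-inj {zero} {zero} _ = refl
      g-inj {zero} {suc β} eq = contradiction (sym eq) (fresh (proj₁ (proj₂ (all β))))
      g-inj {suc α} {zero} eq = contradiction eq (fresh (proj₁ (proj₂ (all α))))
      g-inj {suc α} {suc β} eq = cong suc (trans (sym (cg α)) (trans (cong c eq) (cg β)))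
  ... | α , free = α , λ x∈ fx cx → free (_ , x∈ , fx , cx)

  module Recolour {k : ℕ} (c : E → Fin k) {e : E} {zs : List E}
                  (fresh : ∀ {x} → x ∈ zs → x ≢ e) (α β : Fin k) where

    OnAB : E → Set
    OnAB x = x ≡ e ⊎ (c x ≡ α ⊎ c x ≡ β)
    onAB? : Decidable OnAB
    onAB? x = (x ≟ e) ⊎-dec ((c x ≟F α) ⊎-dec (c x ≟F β))
    H : List E
    H = filter onAB? (e ∷ zs)

    -- `γ` is to be the colour missing at the end of `e` on the side of `f`: α on one side, β on the
    -- other. With it `H` has only two colours, so of three members at a vertex two agree in colour
    -- and coincide.
    atMostTwo : {L : Set} (f : E → L) (γ : Fin k) → γ ≡ α ⊎ γ ≡ β →
                Proper f (extend c e γ) (e ∷ zs) → AtMostTwo f H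
    atMostTwo f γ γ∈ prop {x} {y} {z} x∈ y∈ z∈ xy xz
      with ∈-filter⁻ onAB? {xs = e ∷ zs} x∈ | ∈-filter⁻ onAB? {xs = e ∷ zs} y∈ | ∈-filter⁻ onAB? {xs = e ∷ zs} z∈
    ... | x∈′ , hx | y∈′ , hy | z∈′ , hz with colour x hx | colour y hy | colour z hz
      where
      colour : ∀ w → OnAB w → extend c e γ w ≡ α ⊎ extend c e γ w ≡ β
      colour w h with w ≟ e
      ... | yes _ = γ∈
      colour w (inj₁ w≡e) | no w≢e = contradiction w≡e w≢e
      colour w (inj₂ h) | no _ = h
    ... | inj₁ p | inj₁ q | _ = inj₁ (prop x∈′ y∈′ xy (trans p (sym q)))
    ... | inj₂ p | inj₂ q | _ = inj₁ (prop x∈′ y∈′ xy (trans p (sym q)))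
    ... | inj₁ p | inj₂ _ | inj₁ r = inj₂ (inj₁ (prop x∈′ z∈′ xz (trans p (sym r))))
    ... | inj₂ p | inj₁ _ | inj₂ r = inj₂ (inj₁ (prop x∈′ z∈′ xz (trans p (sym r))))
    ... | inj₁ _ | inj₂ q | inj₂ r = inj₂ (inj₂ (prop y∈′ z∈′ (trans (sym xy) xz) (trans q (sym r))))
    ... | inj₂ _ | inj₁ q | inj₁ r = inj₂ (inj₂ (prop y∈′ z∈′ (trans (sym xy) xz) (trans q (sym r))))

    pick : Bool → Fin k
    pick true = α
    pick false = β
    recoloured : (E → Bool) → E → Fin k
    recoloured d x = if does (onAB? x) then pick (d x) else c x

    pick∈ : ∀ b → pick b ≡ α ⊎ pick b ≡ β
    pick∈ true = inj₁ refl
    pick∈ false = inj₂ refl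

    pick-inj : α ≢ β → ∀ b b′ → pick b ≡ pick b′ → b ≡ b′
    pick-inj _ true true _ = refl
    pick-inj _ false false _ = refl
    pick-inj α≢β true false eq = contradiction eq α≢β
    pick-inj α≢β false true eq = contradiction (sym eq) α≢β

    recoloured-on : ∀ d {x} → OnAB x → recoloured d x ≡ pick (d x)
    recoloured-on d {x} h = cong (if_then pick (d x) else c x) (dec-true (onAB? x) h)

    recoloured-off : ∀ d {x} → ¬ OnAB x → recoloured d x ≡ c x
    recoloured-off d {x} ¬h = cong (if_then pick (d x) else c x) (dec-false (onAB? x) ¬h)

    recoloured-apart : ∀ d {x y} → OnAB x → ¬ OnAB y → recoloured d x ≢ recoloured d y
    recoloured-apart d {x} {y} hx ¬hy eq = ¬hy (inj₂ (subst (λ γ → γ ≡ α ⊎ γ ≡ β) pick≡c (pick∈ (d x))))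
      where
      pick≡c : pick (d x) ≡ c y
      pick≡c = trans (sym (recoloured-on d hx)) (trans eq (recoloured-off d ¬hy))

    recoloured-proper : {L : Set} (f : E → L) (d : E → Bool) → α ≢ β → Proper f c zs → Proper f d H →
                        Proper f (recoloured d) (e ∷ zs)
    recoloured-proper f d α≢β prop propH {x} {y} x∈ y∈ fxy cxy = split (onAB? x) (onAB? y)
      where
      old : ∀ {w} → w ∈ e ∷ zs → ¬ OnAB w → w ∈ zs
      old (here w≡e) ¬h = contradiction (inj₁ w≡e) ¬h
      old (there w∈) _ = w∈
      split : Dec (OnAB x) → Dec (OnAB y) → x ≡ y
      split (yes hx) (yes hy) = propH (∈-filter⁺ onAB? x∈ hx) (∈-filter⁺ onAB? y∈ hy) fxy
        (pick-inj α≢β _ _ (trans (sym (recoloured-on d hx)) (trans cxy (recoloured-on d hy))))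
      split (yes hx) (no ¬hy) = contradiction cxy (recoloured-apart d hx ¬hy)
      split (no ¬hx) (yes hy) = contradiction (sym cxy) (recoloured-apart d hy ¬hx)
      split (no ¬hx) (no ¬hy) = prop (old x∈ ¬hx) (old y∈ ¬hy) fxy
        (trans (sym (recoloured-off d ¬hx)) (trans cxy (recoloured-off d ¬hy)))

  -- A new edge e misses a colour α at one end and β at the other; the edges coloured α or β
  -- together with e have degree at most two, so they are recoloured with α and β.
  colouring : {S T : Set} → DecidableEquality S → DecidableEquality T →
              ∀ k (s : E → S) (t : E → T) xs → AtMost (suc k) s xs → AtMost (suc k) t xs →
              Σ (E → Fin (suc k)) λ c → Proper s c xs × Proper t c xs
  colouring _ _ k s t [] _ _ = (λ _ → zero) , (λ ()) , (λ ())
  colouring {S} {T} _≟S_ _≟T_ k s t (e ∷ ys) degS degT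
    with colouring _≟S_ _≟T_ k s t ys (λ g g∈ → degS g (there ∘ g∈)) (λ g g∈ → degT g (there ∘ g∈))
  ... | c , propS , propT = recolour
    where
    zs = without e ys
    fresh : ∀ {x} → x ∈ zs → x ≢ e
    fresh = proj₂ ∘ ∈-without⁻ ys
    z⇒y : ∀ {x} → x ∈ zs → x ∈ ys
    z⇒y = proj₁ ∘ ∈-without⁻ ys
    sub : ∀ {x} → x ∈ e ∷ zs → x ∈ e ∷ ys
    sub (here eq) = here eq
    sub (there x∈) = there (z⇒y x∈)
    freeS = free-colour _≟S_ (suc k) s c fresh (λ g g∈ → degS g (sub ∘ g∈))
    freeT = free-colour _≟T_ (suc k) t c fresh (λ g g∈ → degT g (sub ∘ g∈))
    α = proj₁ freeS
    β = proj₁ freeT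

    open Recolour c fresh α β

    propS₁ : Proper s (extend c e α) (e ∷ zs)
    propS₁ = extend-proper s c α fresh (proper-⊆ z⇒y propS) (proj₂ freeS)
    propT₁ : Proper t (extend c e β) (e ∷ zs)
    propT₁ = extend-proper t c β fresh (proper-⊆ z⇒y propT) (proj₂ freeT)

    two = twoColouring _≟S_ _≟T_ (length H) H ≤-refl s t
            (atMostTwo s α (inj₁ refl) propS₁) (atMostTwo t β (inj₂ refl) propT₁)
    d = proj₁ two

    recolour : Σ (E → Fin (suc k)) λ c → Proper s c (e ∷ ys) × Proper t c (e ∷ ys)
    recolour with α ≟F β
    -- A colour missing at both ends goes to `e` directly; `pick` separates the two halves only when
    -- α and β differ.
    ... | yes α≡β = extend c e α , proper-⊆ ∈-split propS₁ ,
                    proper-⊆ ∈-split (subst (λ γ → Proper t (extend c e γ) (e ∷ zs)) (sym α≡β) propT₁)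
    ... | no α≢β = recoloured d , proper-⊆ ∈-split (recoloured-proper s d α≢β (proper-⊆ z⇒y propS) (proj₁ (proj₂ two))) ,
                    proper-⊆ ∈-split (recoloured-proper t d α≢β (proper-⊆ z⇒y propT) (proj₂ (proj₂ two)))

-- Counting and Latin arrays

open EdgeColouring using (AtMost; colouring)

lookup-injective : {A : Set} {xs : List A} → Unique xs → ∀ {i j} → lookup xs i ≡ lookup xs j → i ≡ j
lookup-injective (_ ∷ _) {zero} {zero} _ = refl
lookup-injective (x∉ ∷ _) {zero} {suc j} eq = contradiction eq (All.lookup x∉ (∈-lookup j))
lookup-injective (x∉ ∷ _) {suc i} {zero} eq = contradiction (sym eq) (All.lookup x∉ (∈-lookup i))
lookup-injective (_ ∷ u) {suc i} {suc j} eq = cong suc (lookup-injective u eq)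

module _ {A : Set} {P : A → Set} (P? : Decidable P) where

  filter-complement : ∀ xs → length (filter P? xs) + length (filter (¬? ∘ P?) xs) ≡ length xs
  filter-complement [] = refl
  filter-complement (x ∷ xs) with does (P? x)
  ... | true = cong suc (filter-complement xs)
  ... | false = trans (+-suc _ _) (cong suc (filter-complement xs))

  length-filter-map : {B : Set} (h : B → A) → ∀ ys → length (filter P? (map h ys)) ≡ length (filter (P? ∘ h) ys)
  length-filter-map h [] = refl
  length-filter-map h (y ∷ ys) with does (P? (h y))
  ... | true = cong suc (length-filter-map h ys)
  ... | false = length-filter-map h ys

-- Edges are positions of `D`, which keeps parallel demands apart; k + 1 of them with one label
-- would inject into a filtered list of length at most k.
degree⇒AtMost : {A L : Set} (_≟L_ : DecidableEquality L) (f : A → L) (D : List A) {k : ℕ} →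
                (∀ x → length (filter (λ e → f e ≟L x) D) ≤ k) →
                AtMost _≟F_ k (f ∘ lookup D) (allFin (length D))
degree⇒AtMost _≟L_ f D {k} deg g _ g-inj same =
  <⇒notInjective {f = h} (s≤s (≤-trans (≤-reflexive len) (deg x))) h-inj
  where
  x = f (lookup D (g zero))
  P? : Decidable (λ e → f e ≡ x)
  P? e = f e ≟L x
  F = filter (P? ∘ lookup D) (allFin (length D))
  len : length F ≡ length (filter P? D)
  len = trans (sym (length-filter-map P? (lookup D) (allFin (length D))))
              (cong (length ∘ filter P?) (trans (map-tabulate id (lookup D)) (tabulate-lookup D)))
  g∈ : ∀ i → g i ∈ F
  g∈ i = ∈-filter⁺ (P? ∘ lookup D) (∈-allFin (g i)) (same i zero)
  h : Fin (suc k) → Fin (length F)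
  h i = index (g∈ i)
  h-inj : ∀ {i j} → h i ≡ h j → i ≡ j
  h-inj {i} {j} eq = g-inj (trans (lookup-index (g∈ i)) (trans (cong (lookup F) eq) (sym (lookup-index (g∈ j)))))

surjective : ∀ {k} (f : Fin k → Fin k) → (∀ {i j} → f i ≡ f j → i ≡ j) → ∀ y → ∃ λ i → f i ≡ y
surjective {k} f f-inj y with any? (λ i → f i ≟F y)
... | yes p = p
... | no ¬p = ⊥-elim (<⇒notInjective {f = g} (n<1+n k) g-inj)
  where
  g : Fin (suc k) → Fin k
  g zero = y
  g (suc i) = f i
  g-inj : ∀ {i j} → g i ≡ g j → i ≡ j
  g-inj {zero} {zero} _ = refl
  g-inj {zero} {suc j} eq = contradiction (j , sym eq) ¬p
  g-inj {suc i} {zero} eq = contradiction (i , eq) ¬p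
  g-inj {suc i} {suc j} eq = cong suc (f-inj eq)

-- Each row offers k allowed symbols; edge-colouring the bipartite graph of rows and their allowed
-- symbols with k colours makes every colour class a column.
latinArray : ∀ k {a} (sym : Fin k → Fin k → Fin a) → (∀ γ {i j} → sym γ i ≡ sym γ j → i ≡ j) →
             Σ (Fin k → Fin k → Fin k) λ pos →
               (∀ γ {i j} → pos γ i ≡ pos γ j → i ≡ j) ×
               (∀ i {γ δ} → sym γ (pos γ i) ≡ sym δ (pos δ i) → γ ≡ δ)
latinArray zero _ _ = (λ ()) , (λ ()) , λ ()
latinArray k@(suc _) {a} symb symb-inj = pos , pos-inj , column-inj
  where
  E = Fin k × Fin k
  value : E → Fin a
  value (γ , j) = symb γ j
  _≟E_ = ≡-dec _≟F_ _≟F_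
  edges : List E
  edges = cartesianProduct (allFin k) (allFin k)
  every : ∀ e → e ∈ edges
  every (γ , j) = ∈-cartesianProduct⁺ (∈-allFin γ) (∈-allFin j)
  degree₁ : AtMost _≟E_ k proj₁ edges
  degree₁ g _ g-inj same = <⇒notInjective {f = proj₂ ∘ g} (n<1+n k) λ {i} {j} eq → g-inj (cong₂ _,_ (same i j) eq)
  -- A symbol occurs at most once in a row, and there are k rows.
  degree₂ : AtMost _≟E_ k value edges
  degree₂ g _ g-inj same = <⇒notInjective {f = proj₁ ∘ g} (n<1+n k) λ {i} {j} eq →
    g-inj (same-column (g i) (g j) eq (same i j))
    where
    same-column : ∀ e e′ → proj₁ e ≡ proj₁ e′ → value e ≡ value e′ → e ≡ e′
    same-column (γ , _) _ refl eq = cong (γ ,_) (symb-inj γ eq)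
  col = colouring _≟E_ _≟F_ _≟F_ _ proj₁ value edges degree₁ degree₂
  c = proj₁ col
  row-inj : ∀ γ {i j} → c (γ , i) ≡ c (γ , j) → i ≡ j
  row-inj γ eq = cong proj₂ (proj₁ (proj₂ col) (every _) (every _) refl eq)
  -- The k edges of a row have different colours, so each of the k colours, read as a column, occurs
  -- in it.
  inverse : ∀ γ i → ∃ λ j → c (γ , j) ≡ i
  inverse γ = surjective (λ j → c (γ , j)) (row-inj γ)
  pos : Fin k → Fin k → Fin k
  pos γ i = proj₁ (inverse γ i)
  c-pos : ∀ γ i → c (γ , pos γ i) ≡ i
  c-pos γ i = proj₂ (inverse γ i)
  pos-inj : ∀ γ {i j} → pos γ i ≡ pos γ j → i ≡ j
  pos-inj γ {i} {j} eq = trans (sym (c-pos γ i)) (trans (cong (λ p → c (γ , p)) eq) (c-pos γ j))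
  column-inj : ∀ i {γ δ} → symb γ (pos γ i) ≡ symb δ (pos δ i) → γ ≡ δ
  column-inj i {γ} {δ} eq =
    cong proj₁ (proj₂ (proj₂ col) (every (γ , pos γ i)) (every (δ , pos δ i)) eq (trans (c-pos γ i) (sym (c-pos δ i))))

-- The labels show that a row loses at most r of its symbols, so at least k good ones remain for
-- `latinArray` to arrange.
latinArrayAvoiding : ∀ k r {a} → k + r ≤ a → (Bad : Fin k → Fin a → Set) → (∀ γ x → Dec (Bad γ x)) →
                     (label : ∀ {γ x} → Bad γ x → Fin r) →
                     (∀ {γ x y} (p : Bad γ x) (q : Bad γ y) → label p ≡ label q → x ≡ y) →
                     Σ (Fin k → Fin k → Fin a) λ X →
                       (∀ γ {i j} → X γ i ≡ X γ j → i ≡ j) ×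
                       (∀ i {γ δ} → X γ i ≡ X δ i → γ ≡ δ) ×
                       (∀ γ i → ¬ Bad γ (X γ i))
latinArrayAvoiding k r {a} k+r≤a Bad bad? label label-inj =
  (λ γ i → symb γ (pos γ i)) , (λ γ eq → proj₁ (proj₂ latin) γ (symb-inj γ eq)) , proj₂ (proj₂ latin) ,
  λ γ i → proj₂ (∈-filter⁻ (¬? ∘ bad? γ) {xs = allFin a} (∈-lookup {xs = good γ} (inject≤ (pos γ i) (enough γ))))
  where
  bad good : Fin k → List (Fin a)
  bad γ = filter (bad? γ) (allFin a)
  good γ = filter (¬? ∘ bad? γ) (allFin a)
  is-bad : ∀ γ i → Bad γ (lookup (bad γ) i)
  is-bad γ i = proj₂ (∈-filter⁻ (bad? γ) {xs = allFin a} (∈-lookup {xs = bad γ} i))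
  few : ∀ γ → length (bad γ) ≤ r
  few γ = injective⇒≤ {f = label ∘ is-bad γ} λ {i} {j} eq →
    lookup-injective (filter⁺ (bad? γ) (allFin⁺ a)) (label-inj (is-bad γ i) (is-bad γ j) eq)
  enough : ∀ γ → k ≤ length (good γ)
  enough γ = +-cancelʳ-≤ r k (length (good γ))
    (≤-trans k+r≤a (≤-trans (≤-reflexive total) (+-monoʳ-≤ (length (good γ)) (few γ))))
    where
    total : a ≡ length (good γ) + length (bad γ)
    total = trans (sym (length-tabulate id))
                  (trans (sym (filter-complement (bad? γ) (allFin a))) (+-comm (length (bad γ)) (length (good γ))))
  symb : Fin k → Fin k → Fin a
  symb γ i = lookup (good γ) (inject≤ i (enough γ))
  symb-inj : ∀ γ {i j} → symb γ i ≡ symb γ j → i ≡ j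
  symb-inj γ {i} {j} eq = inject≤-injective (enough γ) (enough γ) i j
    (lookup-injective (filter⁺ (¬? ∘ bad? γ) (allFin⁺ a)) eq)
  latin = latinArray k symb symb-inj
  pos = proj₁ latin

-- Members of a class and their ranks

module Classes {n : ℕ} (p : Fin n → Fin 3) where

  members : Fin 3 → List (Fin n)
  members i = filter (λ u → p u ≟F i) (allFin n)

  member : ∀ i → Fin (classSize p i) → Fin n
  member i = lookup (members i)

  member-class : ∀ i j → p (member i j) ≡ i
  member-class i j = proj₂ (∈-filter⁻ (λ u → p u ≟F i) {xs = allFin n} (∈-lookup {xs = members i} j))

  rank : ∀ {i} u → p u ≡ i → Fin (classSize p i)
  rank {i} u eq = index (∈-filter⁺ (λ u → p u ≟F i) (∈-allFin u) eq)

  member-rank : ∀ {i} u (eq : p u ≡ i) → u ≡ member i (rank u eq)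
  member-rank {i} u eq = lookup-index (∈-filter⁺ (λ u → p u ≟F i) (∈-allFin u) eq)

  rank-member : ∀ i j (eq : p (member i j) ≡ i) → rank (member i j) eq ≡ j
  rank-member i j eq = lookup-injective (filter⁺ (λ u → p u ≟F i) (allFin⁺ n)) (sym (member-rank (member i j) eq))

  -- A plain number, so that ranks in classes of different sizes can be compared with one another
  -- and with colours.
  rankℕ : Fin n → ℕ
  rankℕ u = toℕ (rank u refl)

  rankℕ-rank : ∀ {i} u (eq : p u ≡ i) → rankℕ u ≡ toℕ (rank u eq)
  rankℕ-rank u refl = refl

  rankℕ-injective : ∀ {u v} → p u ≡ p v → rankℕ u ≡ rankℕ v → u ≡ v
  rankℕ-injective {u} {v} eq r = trans (member-rank u eq)
    (trans (cong (member (p v)) (toℕ-injective (trans (sym (rankℕ-rank u eq)) r)))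
           (sym (member-rank v refl)))

  rankℕ-member : ∀ i j → rankℕ (member i j) ≡ toℕ j
  rankℕ-member i j = trans (rankℕ-rank (member i j) (member-class i j)) (cong toℕ (rank-member i j _))

  total : classSize p zero + classSize p (suc zero) + classSize p (suc (suc zero)) ≡ n
  total = trans (count (allFin n)) (length-tabulate id)
    where
    size : List (Fin n) → Fin 3 → ℕ
    size xs i = length (filter (λ u → p u ≟F i) xs)
    count : ∀ xs → size xs zero + size xs (suc zero) + size xs (suc (suc zero)) ≡ length xs
    count [] = refl
    count (x ∷ xs) with p x
    ... | zero = cong suc (count xs)
    ... | suc zero = trans (cong (_+ size xs (suc (suc zero))) (+-suc (size xs zero) _)) (cong suc (count xs))
    ... | suc (suc zero) = trans (+-suc (size xs zero + size xs (suc zero)) _) (cong suc (count xs))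

-- Routes

data Route {n} (u v : Fin n) : Set where
  direct : Route u v
  detour : (y x : Fin n) → u ≢ x → y ≢ v → Route u v

-- An edge is named with its end in U first, in whichever direction the path runs through it.
data Uses {n} {u v : Fin n} : Route u v → Fin n → Fin n → Set where
  direct : Uses direct u v
  first  : ∀ {y x p q} → Uses (detour y x p q) u y
  middle : ∀ {y x p q} → Uses (detour y x p q) x y
  last   : ∀ {y x p q} → Uses (detour y x p q) x v

module _ {n : ℕ} where

  Joins : Fin n ⊎ Fin n → Fin n ⊎ Fin n → Fin n → Fin n → Set
  Joins a b x y = (a ≡ inj₁ x × b ≡ inj₂ y) ⊎ (a ≡ inj₂ y × b ≡ inj₁ x)

  joins-unique : ∀ {a b x y x′ y′} → Joins a b x y → Joins a b x′ y′ → x ≡ x′ × y ≡ y′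
  joins-unique (inj₁ (refl , refl)) (inj₁ (refl , refl)) = refl , refl
  joins-unique (inj₂ (refl , refl)) (inj₂ (refl , refl)) = refl , refl

  joins-swap : ∀ {a b x y} → Joins a b x y → Joins b a x y
  joins-swap (inj₁ (p , q)) = inj₂ (q , p)
  joins-swap (inj₂ (p , q)) = inj₁ (q , p)

  -- The ends are given up to equality because an entry of `embedAll D` has the form `embed` only by
  -- `lookup-embedAll`.
  path : ∀ {a b u v} → a ≡ inj₁ u → b ≡ inj₂ v → Route u v → Path (K n) a b
  path {u = u} {v} refl refl direct = record
    { walk = step tt (stop (inj₂ v)) ; distinct = ((λ ()) ∷ []) ∷ [] ∷ [] }
  path {u = u} {v} refl refl (detour y x u≢x y≢v) = record
    { walk = step {b = inj₂ y} tt (step {b = inj₁ x} tt (step tt (stop (inj₂ v))))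
    ; distinct = ((λ ()) ∷ (u≢x ∘ inj₁-injective) ∷ (λ ()) ∷ []) ∷
                 ((λ ()) ∷ (y≢v ∘ inj₂-injective) ∷ []) ∷ ((λ ()) ∷ []) ∷ [] ∷ [] }

  path-traverses : ∀ {a b u v} (p : a ≡ inj₁ u) (q : b ≡ inj₂ v) (ρ : Route u v) {g h} →
                   Traverses (walk (path p q ρ)) g h → ∃ λ x → ∃ λ y → Uses ρ x y × Joins g h x y
  path-traverses refl refl direct (here _ _) = _ , _ , direct , inj₁ (refl , refl)
  path-traverses refl refl direct (there _ ())
  path-traverses refl refl (detour y x _ _) (here _ _) = _ , _ , first , inj₁ (refl , refl)
  path-traverses refl refl (detour y x _ _) (there _ (here _ _)) = _ , _ , middle , inj₂ (refl , refl)
  path-traverses refl refl (detour y x _ _) (there _ (there _ (here _ _))) = _ , _ , last , inj₁ (refl , refl)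
  path-traverses refl refl (detour y x _ _) (there _ (there _ (there _ ())))

  path-uses : ∀ {a b u v} (p : a ≡ inj₁ u) (q : b ≡ inj₂ v) (ρ : Route u v) {g h} →
              UsesEdge (path p q ρ) g h → ∃ λ x → ∃ λ y → Uses ρ x y × Joins g h x y
  path-uses p q ρ (inj₁ tr) = path-traverses p q ρ tr
  path-uses p q ρ (inj₂ tr) with path-traverses p q ρ tr
  ... | x , y , use , joins = x , y , use , joins-swap joins

  position : (D : List (Fin n × Fin n)) → Fin (length (embedAll D)) → Fin (length D)
  position (_ ∷ _) zero = zero
  position (_ ∷ D) (suc i) = suc (position D i)

  position-injective : ∀ D {i j} → position D i ≡ position D j → i ≡ j
  position-injective (_ ∷ _) {zero} {zero} _ = refl
  position-injective (_ ∷ D) {suc i} {suc j} eq = cong suc (position-injective D (suc-injective eq))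

  lookup-embedAll : ∀ D i → lookup (embedAll D) i ≡ embed (lookup D (position D i))
  lookup-embedAll (_ ∷ _) zero = refl
  lookup-embedAll (_ ∷ D) (suc i) = lookup-embedAll D i

  EdgeDisjoint : {m : ℕ} {s t : Fin m → Fin n} → (∀ e → Route (s e) (t e)) → Set
  EdgeDisjoint ρ = ∀ {e e′ x y} → Uses (ρ e) x y → Uses (ρ e′) x y → e ≡ e′

  resolvable : (D : List (Fin n × Fin n)) (ρ : ∀ e → Route (proj₁ (lookup D e)) (proj₂ (lookup D e))) →
               EdgeDisjoint ρ → Resolvable (K n) (embedAll D)
  resolvable D ρ disjoint = (λ i → path (fst i) (snd i) (ρ (position D i))) , separate
    where
    fst : ∀ i → proj₁ (lookup (embedAll D) i) ≡ inj₁ (proj₁ (lookup D (position D i)))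
    fst i = cong proj₁ (lookup-embedAll D i)
    snd : ∀ i → proj₂ (lookup (embedAll D) i) ≡ inj₂ (proj₂ (lookup D (position D i)))
    snd i = cong proj₂ (lookup-embedAll D i)
    separate : ∀ i j → i ≢ j → ∀ g h → UsesEdge (path (fst i) (snd i) (ρ (position D i))) g h →
               ¬ UsesEdge (path (fst j) (snd j) (ρ (position D j))) g h
    separate i j i≢j g h p q with path-uses (fst i) (snd i) _ p | path-uses (fst j) (snd j) _ q
    ... | x , y , use , joins | x′ , y′ , use′ , joins′ with joins-unique joins joins′
    ... | refl , refl = i≢j (position-injective D (disjoint use use′))

-- Offset a γ v σ says σ ≡ v − γ modulo a, for γ, v, σ < a.
data Offset (a γ v σ : ℕ) : Set where
  plain   : σ + γ ≡ v → Offset a γ v σ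
  wrapped : σ + γ ≡ v + a → Offset a γ v σ

-- The sum σ + γ is symmetric, so a slot may be read as a shift; this is how γ is recovered from v
-- and σ.
offset-swap : ∀ {a γ v σ} → Offset a γ v σ → Offset a σ v γ
offset-swap {γ = γ} {σ = σ} (plain p) = plain (trans (+-comm γ σ) p)
offset-swap {γ = γ} {σ = σ} (wrapped p) = wrapped (trans (+-comm γ σ) p)

<⇒≢+ : ∀ {a v} w → v < a → v ≢ w + a
<⇒≢+ {a} w v<a refl = <⇒≱ v<a (m≤n+m a w)

offset-end : ∀ {a γ v v′ σ} → v < a → v′ < a → Offset a γ v σ → Offset a γ v′ σ → v ≡ v′
offset-end _ _ (plain p) (plain q) = trans (sym p) q
offset-end {v′ = v′} v<a _ (plain p) (wrapped q) = contradiction (trans (sym p) q) (<⇒≢+ v′ v<a)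
offset-end {v = v} _ v′<a (wrapped p) (plain q) = contradiction (trans (sym q) p) (<⇒≢+ v v′<a)
offset-end {a} _ _ (wrapped p) (wrapped q) = +-cancelʳ-≡ a _ _ (trans (sym p) q)

offset-unique : ∀ {a γ v σ σ′} → σ < a → σ′ < a → Offset a γ v σ → Offset a γ v σ′ → σ ≡ σ′
offset-unique {γ = γ} _ _ (plain p) (plain q) = +-cancelʳ-≡ γ _ _ (trans p (sym q))
offset-unique {γ = γ} _ _ (wrapped p) (wrapped q) = +-cancelʳ-≡ γ _ _ (trans p (sym q))
offset-unique {a} {γ} {σ = σ} {σ′} _ σ′<a (plain p) (wrapped q) =
  contradiction (+-cancelʳ-≡ γ σ′ (σ + a) (trans q (shift p))) (<⇒≢+ σ σ′<a)
  where
  shift : ∀ {v} → σ + γ ≡ v → v + a ≡ σ + a + γ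
  shift refl = trans (+-assoc σ γ a) (trans (cong (σ +_) (+-comm γ a)) (sym (+-assoc σ a γ)))
offset-unique σ<a σ′<a p@(wrapped _) q@(plain _) = sym (offset-unique σ′<a σ<a q p)

offset-start : ∀ {a γ γ′ v σ} → γ < a → γ′ < a → Offset a γ v σ → Offset a γ′ v σ → γ ≡ γ′
offset-start γ<a γ′<a p q = offset-unique γ<a γ′<a (offset-swap p) (offset-swap q)

end-exists : ∀ {a γ σ} → γ < a → σ < a → ∃ λ v → v < a × Offset a γ v σ
end-exists {a} {γ} {σ} γ<a σ<a with σ + γ <? a
... | yes small = σ + γ , small , plain refl
... | no big = σ + γ ∸ a , +-cancelʳ-< a _ _ (subst (_< a + a) (sym eq) (+-mono-< σ<a γ<a)) , wrapped (sym eq)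
  where
  eq : σ + γ ∸ a + a ≡ σ + γ
  eq = m∸n+n≡m (≮⇒≥ big)

offset : ℕ → ℕ → ℕ → ℕ
offset a γ v with γ ≤? v
... | yes _ = v ∸ γ
... | no _ = v + a ∸ γ

offset-correct : ∀ {a γ v} → γ < a → v < a → Offset a γ v (offset a γ v) × offset a γ v < a
offset-correct {a} {γ} {v} γ<a v<a with γ ≤? v
... | yes γ≤v = plain (m∸n+n≡m γ≤v) , ≤-<-trans (m∸n≤m v γ) v<a
... | no γ≰v = wrapped eq ,
  +-cancelʳ-< γ _ _ (subst (_< a + γ) (sym eq) (subst (v + a <_) (+-comm γ a) (+-monoˡ-< a (≰⇒> γ≰v))))
  where
  eq : v + a ∸ γ + γ ≡ v + a
  eq = m∸n+n≡m (≤-trans (<⇒≤ γ<a) (m≤n+m a v))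

-- Demands in rank coordinates

data Class : Set where
  A B C : Class

-- All that routing needs to know, with the classes already named A, B, C; each of the three
-- rotations of the partition gives such a record.
record Demands (n m k : ℕ) : Set where
  field
    s t          : Fin m → Fin n
    c            : Fin m → Fin k
    proper-s     : ∀ {e e′} → s e ≡ s e′ → c e ≡ c e′ → e ≡ e′
    proper-t     : ∀ {e e′} → t e ≡ t e′ → c e ≡ c e′ → e ≡ e′
    classU classV : Fin n → Class
    rankU rankV  : Fin n → ℕ
    size         : Class → ℕ
    rankV<size   : ∀ v → rankV v < size (classV v)
    rankV-inj    : ∀ {v v′} → classV v ≡ classV v′ → rankV v ≡ rankV v′ → v ≡ v′
    vertexU      : ∀ i {j} → j < size i → ∃ λ u → classU u ≡ i × rankU u ≡ j
    vertexV      : ∀ i {j} → j < size i → ∃ λ v → classV v ≡ i × rankV v ≡ j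
    within       : ∀ e → classU (s e) ≡ classV (t e)

  γ : Fin m → ℕ
  γ e = toℕ (c e)

  γ<k : ∀ e → γ e < k
  γ<k e = toℕ<n (c e)

  kind : Fin m → Class
  kind e = classV (t e)

  goal : Fin m → ℕ
  goal e = rankV (t e)

  goal< : ∀ {e i} → kind e ≡ i → goal e < size i
  goal< {e} refl = rankV<size (t e)

  by-source : ∀ {e e′ x} → x ≡ s e → x ≡ s e′ → γ e ≡ γ e′ → e ≡ e′
  by-source p q eq = proper-s (trans (sym p) q) (toℕ-injective eq)

  by-target : ∀ {e e′ y} → y ≡ t e → y ≡ t e′ → γ e ≡ γ e′ → e ≡ e′
  by-target p q eq = proper-t (trans (sym p) q) (toℕ-injective eq)

  by-goal : ∀ {e e′ i} → kind e ≡ i → kind e′ ≡ i → goal e ≡ goal e′ → γ e ≡ γ e′ → e ≡ e′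
  by-goal p q r = by-target refl (sym (rankV-inj (trans q (sym p)) (sym r)))

  -- Claim i j e x y: the property, recorded per block (i , j) of K n, of an edge (x , y) of that
  -- block lying on the route of e.
  module Routing (Claim : Class → Class → Fin m → Fin n → Fin n → Set) where

    Routed : Fin m → Set
    Routed e = Σ (Route (s e) (t e)) λ ρ → ∀ {x y} → Uses ρ x y → Claim (classU x) (classV y) e x y

    claim : ∀ {i j e x y} → classU x ≡ i → classV y ≡ j → Claim i j e x y → Claim (classU x) (classV y) e x y
    claim refl refl z = z

    sourceClass : ∀ {e i} → kind e ≡ i → classU (s e) ≡ i
    sourceClass {e} eq = trans (within e) eq

    -- Here `y` may lie in the class of the demand itself, as on the routes via a hub, so `y ≢ t e`
    -- has to be assumed, whereas `s e ≢ x` follows from the classes.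
    detourThrough : ∀ {e i j l x y} → kind e ≡ i → classV y ≡ j → classU x ≡ l → i ≢ l → y ≢ t e →
                    Claim i j e (s e) y → Claim l j e x y → Claim l i e x (t e) → Routed e
    detourThrough {e} {x = x} {y} ki yj xl i≢l y≢t f g h =
      detour y x (λ eq → i≢l (trans (sym (sourceClass ki)) (trans (cong classU eq) xl))) y≢t ,
      λ { first → claim (sourceClass ki) yj f ; middle → claim xl yj g ; last → claim xl ki h }

    detourOutside : ∀ {e i j x y} → kind e ≡ i → classV y ≡ j → classU x ≡ j → i ≢ j →
                    Claim i j e (s e) y → Claim j j e x y → Claim j i e x (t e) → Routed e
    detourOutside ki yj xj i≢j =
      detourThrough ki yj xj i≢j (λ eq → i≢j (trans (sym ki) (trans (sym (cong classV eq)) yj)))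

    edgeDisjoint : (routed : ∀ e → Routed e) →
                   (∀ i j {e e′ x y} → classU x ≡ i → classV y ≡ j → Claim i j e x y → Claim i j e′ x y → e ≡ e′) →
                   EdgeDisjoint (λ e → proj₁ (routed e))
    edgeDisjoint routed determines p q =
      determines _ _ refl refl (proj₂ (routed _) p) (proj₂ (routed _) q)

-- The two patterns of class sizes

_≟C_ : DecidableEquality Class
A ≟C A = yes refl
A ≟C B = no λ ()
A ≟C C = no λ ()
B ≟C A = no λ ()
B ≟C B = yes refl
B ≟C C = no λ ()
C ≟C A = no λ ()
C ≟C B = no λ ()
C ≟C C = yes refl

-- Sizes (k + r, k, k). In rank coordinates an A-demand (u , v) of colour γ has slot σ ≡ v − γ
-- modulo a = k + r. For σ < k it uses the edge σγ of the B-block as its middle edge. The at most two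
-- slots k, …, a − 1 per colour do not fit there: the demand in the last slot, ending at the vertex
-- hub γ = γ − 1, goes directly, and for r = 2 the one in slot k, ending at γ − 2, goes via hub γ
-- and vertex γ of the B-block, whose edges to γ − 1 and γ − 2 are unused because the slots
-- v − γ of colours γ < k miss them. This occupies at most r edges of the A-block, all at hub γ,
-- so k edges at hub γ remain for the C-demands of colour γ.
module OneLarge {n m k r : ℕ} (I : Demands n m k) (r≤2 : r ≤ 2) (size-A : Demands.size I A ≡ k + r)
                (size-B : Demands.size I B ≡ k) (size-C : Demands.size I C ≡ k) where

  open Demands I

  a : ℕ
  a = k + r

  k≤a : k ≤ a
  k≤a = m≤m+n k r

  γ<a : ∀ e → γ e < a
  γ<a e = <-≤-trans (γ<k e) k≤a

  slot : Fin m → ℕ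
  slot e = offset a (γ e) (goal e)

  goal<a : ∀ {e} → kind e ≡ A → goal e < a
  goal<a {e} eq = subst (goal e <_) size-A (goal< eq)

  slot-offset : ∀ {e} → kind e ≡ A → Offset a (γ e) (goal e) (slot e)
  slot-offset {e} eq = proj₁ (offset-correct (γ<a e) (goal<a eq))

  slot<a : ∀ {e} → kind e ≡ A → slot e < a
  slot<a {e} eq = proj₂ (offset-correct (γ<a e) (goal<a eq))

  -- The colour of a demand is a number below `a`, so `a` is positive and `pred a` is really the
  -- last slot.
  a>0 : ∀ e → pred a < a
  a>0 e = positive (≤-trans (s≤s z≤n) (γ<a e))
    where
    positive : ∀ {b} → 0 < b → pred b < b
    positive {suc b} _ = n<1+n b

  hub : ∀ e → ∃ λ v → v < a × Offset a (γ e) v (pred a)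
  hub e = end-exists (γ<a e) (a>0 e)

  -- The edge from `x` to the hub of colour `δ` is taken by an A-demand, either as its direct route
  -- or as the first edge of its detour.
  Bad : Fin k → Fin a → Set
  Bad δ x = ∃ λ e → kind e ≡ A × c e ≡ δ × rankU (s e) ≡ toℕ x × k ≤ slot e

  bad? : ∀ δ x → Dec (Bad δ x)
  bad? δ x = any? λ e → (kind e ≟C A) ×-dec (c e ≟F δ) ×-dec (rankU (s e) ≟ℕ toℕ x) ×-dec (k ≤? slot e)

  excess< : ∀ {e} → kind e ≡ A → k ≤ slot e → slot e ∸ k < r
  excess< {e} eq k≤ = +-cancelˡ-< k _ _ (subst (_< a) (sym (m+[n∸m]≡n k≤)) (slot<a eq))

  label : ∀ {δ x} → Bad δ x → Fin r
  label (e , eq , _ , _ , k≤) = fromℕ< (excess< eq k≤)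

  same-slot : ∀ {e e′} → kind e ≡ A → kind e′ ≡ A → c e ≡ c e′ → slot e ≡ slot e′ → e ≡ e′
  same-slot {e} {e′} p q cc ss = by-goal p q
    (offset-end (goal<a p) (goal<a q) (slot-offset p)
      (subst₂ (λ g σ → Offset a g (goal e′) σ) (cong toℕ (sym cc)) (sym ss) (slot-offset q)))
    (cong toℕ cc)

  -- Colour and slot determine the target and hence the demand, so a colour has at most one demand
  -- in each of the r overflowing slots.
  label-inj : ∀ {δ x y} (p : Bad δ x) (q : Bad δ y) → label p ≡ label q → x ≡ y
  label-inj (e , p , ce , se , k≤) (e′ , q , ce′ , se′ , k≤′) eq =
    toℕ-injective (trans (sym se) (trans (cong (rankU ∘ s) (same-slot p q (trans ce (sym ce′)) ss)) se′))
    where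
    ss : slot e ≡ slot e′
    ss = ∸-cancelʳ-≡ k≤ k≤′ (trans (sym (toℕ-fromℕ< (excess< p k≤)))
                            (trans (cong toℕ eq) (toℕ-fromℕ< (excess< q k≤′))))

  -- Rows are colours, columns are target ranks in class C. Injective rows separate the middle edges
  -- at a hub, injective columns the last edges at a target.
  array = latinArrayAvoiding k r ≤-refl Bad bad? label label-inj
  X = proj₁ array
  X-row = proj₁ (proj₂ array)
  X-col = proj₁ (proj₂ (proj₂ array))
  X-good = proj₂ (proj₂ (proj₂ array))

  Claim : Class → Class → Fin m → Fin n → Fin n → Set
  Claim A A e x y = Offset a (γ e) (rankV y) (pred a) ×
    ((kind e ≡ A × x ≡ s e × k ≤ slot e) ⊎
     (kind e ≡ C × ∃ λ q → toℕ q ≡ goal e × rankU x ≡ toℕ (X (c e) q)))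
  Claim A B e x y = x ≡ s e × rankV y ≡ γ e
  Claim A C e x y = y ≡ t e × ∃ λ q → toℕ q ≡ goal e × rankU x ≡ toℕ (X (c e) q)
  -- Edges of this block are sorted by the difference ρ of their ranks modulo `a`: colours give the
  -- ordinary last edges, k and k + 1 the last and middle edges of the detours of demands in slot k.
  Claim B A e x y = ∃ λ ρ → ρ < a × Offset a ρ (rankV y) (rankU x) ×
    ((ρ ≡ γ e × y ≡ t e) ⊎
     (ρ ≡ k × rankU x ≡ γ e × y ≡ t e) ⊎
     (ρ ≡ suc k × rankU x ≡ γ e × kind e ≡ A × Offset a (γ e) (goal e) k))
  Claim B B e x y = kind e ≡ A × rankV y ≡ γ e × rankU x < a × Offset a (γ e) (goal e) (rankU x)
  Claim B C e x y = x ≡ s e × rankV y ≡ γ e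
  Claim C A e x y = x ≡ s e × Offset a (γ e) (rankV y) (pred a)
  Claim C B e x y = y ≡ t e × Offset k (γ e) (rankV y) (rankU x)
  Claim C C e x y = kind e ≡ B × rankV y ≡ γ e × Offset k (γ e) (goal e) (rankU x)

  open Routing Claim

  by-hub : ∀ {e e′ v} → Offset a (γ e) v (pred a) → Offset a (γ e′) v (pred a) → γ e ≡ γ e′
  by-hub {e} {e′} = offset-start (γ<a e) (γ<a e′)

  determines : ∀ i j {e e′ x y} → classU x ≡ i → classV y ≡ j → Claim i j e x y → Claim i j e′ x y → e ≡ e′
  determines A A {e} {e′} _ _ (h , inj₁ (_ , p , _)) (h′ , inj₁ (_ , p′ , _)) = by-source p p′ (by-hub h h′)
  determines A A {e} {e′} _ _ (h , inj₁ (ke , refl , k≤)) (h′ , inj₂ (_ , q , _ , i)) =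
    contradiction (e , ke , toℕ-injective (by-hub h h′) , i , k≤) (X-good (c e′) q)
  determines A A {e} {e′} _ _ (h , inj₂ (_ , q , _ , i)) (h′ , inj₁ (ke′ , refl , k≤)) =
    contradiction (e′ , ke′ , toℕ-injective (by-hub h′ h) , i , k≤) (X-good (c e) q)
  determines A A {e} {e′} _ _ (h , inj₂ (ke , q , qe , i)) (h′ , inj₂ (ke′ , q′ , qe′ , i′)) =
    by-goal ke ke′ (trans (sym qe) (trans (cong toℕ (X-row (c e) X≡)) qe′)) (by-hub h h′)
    where
    X≡ : X (c e) q ≡ X (c e) q′
    X≡ = toℕ-injective (trans (sym i) (trans i′ (cong (λ δ → toℕ (X δ q′)) (toℕ-injective (by-hub h′ h)))))
  determines A B {e} {e′} _ _ (p , j) (p′ , j′) = by-source p p′ (trans (sym j) j′)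
  determines A C {e} {e′} _ _ (p , q , qe , i) (p′ , q′ , qe′ , i′) =
    by-target p p′ (cong toℕ (X-col q (toℕ-injective
      (trans (sym i) (trans i′ (cong (toℕ ∘ X (c e′)) (toℕ-injective
        (trans qe′ (trans (cong rankV (trans (sym p′) p)) (sym qe))))))))))
  determines B A {e} {e′} xB yA (ρ , ρ<a , o , z) (ρ′ , ρ′<a , o′ , z′) = go (offset-start ρ<a ρ′<a o o′) z z′
    where
    go : ρ ≡ ρ′ → _ → _ → e ≡ e′
    go eq (inj₁ (p , y)) (inj₁ (p′ , y′)) = by-target y y′ (trans (sym p) (trans eq p′))
    go eq (inj₁ (p , _)) (inj₂ (inj₁ (p′ , _))) = contradiction (trans (sym p) (trans eq p′)) (<⇒≢ (γ<k e))
    go eq (inj₁ (p , _)) (inj₂ (inj₂ (p′ , _))) = contradiction (trans (sym p) (trans eq p′)) (<⇒≢ (m<n⇒m<1+n (γ<k e)))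
    go eq (inj₂ (inj₁ (p , _))) (inj₁ (p′ , _)) = contradiction (trans (sym p′) (trans (sym eq) p)) (<⇒≢ (γ<k e′))
    go eq (inj₂ (inj₂ (p , _))) (inj₁ (p′ , _)) = contradiction (trans (sym p′) (trans (sym eq) p)) (<⇒≢ (m<n⇒m<1+n (γ<k e′)))
    go eq (inj₂ (inj₁ (_ , i , y))) (inj₂ (inj₁ (_ , i′ , y′))) = by-target y y′ (trans (sym i) i′)
    go eq (inj₂ (inj₁ (p , _))) (inj₂ (inj₂ (p′ , _))) = contradiction (trans (sym p) (trans eq p′)) (<⇒≢ (n<1+n k))
    go eq (inj₂ (inj₂ (p , _))) (inj₂ (inj₁ (p′ , _))) = contradiction (trans (sym p′) (trans (sym eq) p)) (<⇒≢ (n<1+n k))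
    go eq (inj₂ (inj₂ (_ , i , ke , g))) (inj₂ (inj₂ (_ , i′ , ke′ , g′))) =
      by-goal ke ke′ (offset-end (goal<a ke) (goal<a ke′) g
                       (subst (λ δ → Offset a δ (goal e′) k) (trans (sym i′) i) g′)) (trans (sym i) i′)
  determines B B {e} {e′} _ _ (ke , j , x<a , o) (ke′ , j′ , _ , o′) =
    by-goal ke ke′ (offset-end (goal<a ke) (goal<a ke′) o
                     (subst (λ δ → Offset a δ (goal e′) _) (trans (sym j′) j) o′)) (trans (sym j) j′)
  determines B C {e} {e′} _ _ (p , j) (p′ , j′) = by-source p p′ (trans (sym j) j′)
  determines C A {e} {e′} _ _ (p , h) (p′ , h′) = by-source p p′ (by-hub h h′)
  determines C B {e} {e′} _ _ (p , o) (p′ , o′) = by-target p p′ (offset-start (γ<k e) (γ<k e′) o o′)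
  determines C C {e} {e′} _ _ (ke , j , o) (ke′ , j′ , o′) =
    by-goal ke ke′ (offset-end (subst (goal e <_) size-B (goal< ke)) (subst (goal e′ <_) size-B (goal< ke′)) o
                     (subst (λ δ → Offset k δ (goal e′) _) (trans (sym j′) j) o′)) (trans (sym j) j′)

  routeA : ∀ e → kind e ≡ A → Routed e
  routeA e ke with slot e <? k
  ... | yes σ<k with vertexV B (subst (γ e <_) (sym size-B) (γ<k e)) | vertexU B (subst (slot e <_) (sym size-B) σ<k)
  ...   | y , yB , yγ | x , xB , xσ = detourOutside ke yB xB (λ ())
    (refl , yγ)
    (ke , yγ , subst (_< a) (sym xσ) (slot<a ke) , subst (Offset a (γ e) (goal e)) (sym xσ) (slot-offset ke))
    (γ e , γ<a e , subst (Offset a (γ e) (goal e)) (sym xσ) (slot-offset ke) , inj₁ (refl , refl))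
  routeA e ke | no σ≮k with slot e ≟ℕ pred a
  ... | yes σ≡ = direct , λ { direct → claim (sourceClass ke) ke
          (subst (Offset a (γ e) (goal e)) σ≡ (slot-offset ke) , inj₁ (ke , refl , ≮⇒≥ σ≮k)) }
  ... | no σ≢ with hub e
  ...   | h , h<a , oh with vertexV A (subst (h <_) (sym size-A) h<a) | vertexU B (subst (γ e <_) (sym size-B) (γ<k e))
  ...     | y , yA , yh | x , xB , xγ = detourThrough ke yA xB (λ ()) y≢t
    (subst (λ v → Offset a (γ e) v (pred a)) (sym yh) oh , inj₁ (ke , refl , ≮⇒≥ σ≮k))
    (suc k , subst (suc k <_) (sym a≡) (n<1+n (suc k)) ,
      -- Here a = k + 2, so h - γ is k + 1. Swapped, h - (k + 1) is γ, the rank of `x`.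
      subst₂ (Offset a (suc k)) (sym yh) (sym xγ) (offset-swap (subst (Offset a (γ e) h) (cong pred a≡) oh)) ,
      inj₂ (inj₂ (refl , xγ , ke , ok)))
    (k , subst (k <_) (sym a≡) (m<n⇒m<1+n (n<1+n k)) ,
      subst (Offset a k (goal e)) (sym xγ) (offset-swap ok) , inj₂ (inj₁ (refl , xγ , refl)))
    where
    -- The slots outside [0, k) are k, …, k + r − 1 with r ≤ 2, so one that is not the last is k.
    squeeze : ∀ {k σ r} → r ≤ 2 → k ≤ σ → σ < k + r → σ ≢ pred (k + r) → σ ≡ k × k + r ≡ suc (suc k)
    squeeze {k} {r = zero} _ k≤σ σ< _ = contradiction (≤-trans σ< (≤-trans (≤-reflexive (+-identityʳ k)) k≤σ)) (<-irrefl refl)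
    squeeze {k} {r = suc zero} _ k≤σ σ< ≢ rewrite +-comm k 1 = contradiction (≤-antisym (≤-pred σ<) k≤σ) ≢
    squeeze {k} {r = suc (suc zero)} _ k≤σ σ< ≢ rewrite +-comm k 2 = ≤-antisym (≤-pred (≤∧≢⇒< (≤-pred σ<) ≢)) k≤σ , refl
    squeeze {r = suc (suc (suc _))} (s≤s (s≤s ())) _ _ _
    σ≡k = proj₁ (squeeze {r = r} r≤2 (≮⇒≥ σ≮k) (slot<a ke) σ≢)
    a≡ = proj₂ (squeeze {r = r} r≤2 (≮⇒≥ σ≮k) (slot<a ke) σ≢)
    ok : Offset a (γ e) (goal e) k
    ok = subst (Offset a (γ e) (goal e)) σ≡k (slot-offset ke)
    y≢t : y ≢ t e
    -- A demand ending at its hub would have the last slot.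
    y≢t refl = σ≢ (offset-unique (slot<a ke) (a>0 e) (slot-offset ke)
                     (subst (λ v → Offset a (γ e) v (pred a)) (sym yh) oh))

  routeB : ∀ e → kind e ≡ B → Routed e
  routeB e ke with offset-correct (γ<k e) (subst (goal e <_) size-B (goal< ke))
  ... | o , σ<k with vertexV C (subst (γ e <_) (sym size-C) (γ<k e)) | vertexU C (subst (_ <_) (sym size-C) σ<k)
  ...   | y , yC , yγ | x , xC , xσ = detourOutside ke yC xC (λ ())
    (refl , yγ) (ke , yγ , o′) (refl , o′)
    where
    o′ = subst (Offset k (γ e) (goal e)) (sym xσ) o

  routeC : ∀ e → kind e ≡ C → Routed e
  routeC e ke = build (vertexV A (subst (proj₁ (hub e) <_) (sym size-A) (proj₁ (proj₂ (hub e)))))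
                      (vertexU A (subst (toℕ (X (c e) q) <_) (sym size-A) (toℕ<n (X (c e) q))))
    where
    q = fromℕ< (subst (goal e <_) size-C (goal< ke))
    build : (∃ λ y → classV y ≡ A × rankV y ≡ proj₁ (hub e)) →
            (∃ λ x → classU x ≡ A × rankU x ≡ toℕ (X (c e) q)) → Routed e
    build (y , yA , yh) (x , xA , xX) =
      detourOutside ke yA xA (λ ()) (refl , oh) (oh , inj₂ (ke , q , qe , xX)) (refl , q , qe , xX)
      where
      qe : toℕ q ≡ goal e
      qe = toℕ-fromℕ< (subst (goal e <_) size-C (goal< ke))
      oh : Offset a (γ e) (rankV y) (pred a)
      oh = subst (λ v → Offset a (γ e) v (pred a)) (sym yh) (proj₂ (proj₂ (hub e)))

  routed : ∀ e → Routed e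
  routed e with kind e in ke
  ... | A = routeA e ke
  ... | B = routeB e ke
  ... | C = routeC e ke

  disjoint : EdgeDisjoint (λ e → proj₁ (routed e))
  disjoint = edgeDisjoint routed determines

-- Sizes (k + 1, k, k + 1). An A-demand ending at rank k has no room in the B-block. It uses instead
-- the single edge from vertex γ of V_B to U_C that the B-demands, shifted modulo k + 1, leave free.
module OneSmall {n m k : ℕ} (I : Demands n m k) (size-A : Demands.size I A ≡ suc k)
                (size-B : Demands.size I B ≡ k) (size-C : Demands.size I C ≡ suc k) where

  open Demands I

  γ<a : ∀ e → γ e < suc k
  γ<a e = m<n⇒m<1+n (γ<k e)

  Claim : Class → Class → Fin m → Fin n → Fin n → Set
  Claim A A e x y = kind e ≡ C × rankV y ≡ γ e × Offset (suc k) (γ e) (goal e) (rankU x)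
  Claim A B e x y = x ≡ s e × rankV y ≡ γ e
  Claim A C e x y = y ≡ t e × Offset (suc k) (γ e) (rankV y) (rankU x)
  -- The modulus is k, the size of B, since only targets of rank below k are served here.
  Claim B A e x y = y ≡ t e × Offset k (γ e) (rankV y) (rankU x)
  Claim B B e x y = kind e ≡ A × goal e < k × rankV y ≡ γ e × Offset k (γ e) (goal e) (rankU x)
  Claim B C e x y = x ≡ s e × rankV y ≡ γ e
  -- First edges of C-demands end at ranks that are colours, hence below k; the vertex of rank k in
  -- class A is free for the last edges of the exceptional A-demands.
  Claim C A e x y = (y ≡ t e × goal e ≡ k × Offset (suc k) k (γ e) (rankU x)) ⊎ (x ≡ s e × rankV y ≡ γ e)
  Claim C B e x y = (kind e ≡ A × goal e ≡ k × rankV y ≡ γ e × Offset (suc k) k (rankV y) (rankU x)) ⊎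
                    (y ≡ t e × Offset (suc k) (γ e) (rankV y) (rankU x))
  Claim C C e x y = kind e ≡ B × rankV y ≡ γ e × Offset (suc k) (γ e) (goal e) (rankU x)

  open Routing Claim

  same-goal : ∀ {a e e′ i j x} → kind e ≡ i → kind e′ ≡ i → goal e < a → goal e′ < a →
              j ≡ γ e → j ≡ γ e′ → Offset a (γ e) (goal e) x → Offset a (γ e′) (goal e′) x → e ≡ e′
  same-goal {a} {e} {e′} ke ke′ g g′ j j′ o o′ =
    by-goal ke ke′ (offset-end g g′ o (subst (λ δ → Offset a δ (goal e′) _) (trans (sym j′) j) o′)) (trans (sym j) j′)

  goalC< : ∀ {e} → kind e ≡ C → goal e < suc k
  goalC< {e} ke = subst (goal e <_) size-C (goal< ke)

  goalB< : ∀ {e} → kind e ≡ B → goal e < k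
  goalB< {e} ke = subst (goal e <_) size-B (goal< ke)

  determines : ∀ i j {e e′ x y} → classU x ≡ i → classV y ≡ j → Claim i j e x y → Claim i j e′ x y → e ≡ e′
  determines A A {e} {e′} _ _ (ke , j , o) (ke′ , j′ , o′) = same-goal ke ke′ (goalC< ke) (goalC< ke′) j j′ o o′
  determines A B {e} {e′} _ _ (p , j) (p′ , j′) = by-source p p′ (trans (sym j) j′)
  determines A C {e} {e′} _ _ (p , o) (p′ , o′) = by-target p p′ (offset-start (γ<a e) (γ<a e′) o o′)
  determines B A {e} {e′} _ _ (p , o) (p′ , o′) = by-target p p′ (offset-start (γ<k e) (γ<k e′) o o′)
  determines B B {e} {e′} _ _ (ke , g , j , o) (ke′ , g′ , j′ , o′) = same-goal ke ke′ g g′ j j′ o o′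
  determines B C {e} {e′} _ _ (p , j) (p′ , j′) = by-source p p′ (trans (sym j) j′)
  determines C A {e} {e′} _ _ (inj₁ (p , _ , o)) (inj₁ (p′ , _ , o′)) = by-target p p′ (offset-end (γ<a e) (γ<a e′) o o′)
  determines C A {e} {e′} _ _ (inj₁ (refl , g , _)) (inj₂ (_ , j)) = contradiction (trans (sym j) g) (<⇒≢ (γ<k e′))
  determines C A {e} {e′} _ _ (inj₂ (_ , j)) (inj₁ (refl , g , _)) = contradiction (trans (sym j) g) (<⇒≢ (γ<k e))
  determines C A {e} {e′} _ _ (inj₂ (p , j)) (inj₂ (p′ , j′)) = by-source p p′ (trans (sym j) j′)
  determines C B {e} {e′} _ _ (inj₁ (ke , g , j , _)) (inj₁ (ke′ , g′ , j′ , _)) =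
    by-goal ke ke′ (trans g (sym g′)) (trans (sym j) j′)
  determines C B {e} {e′} _ _ (inj₁ (_ , _ , _ , o)) (inj₂ (_ , o′)) =
    contradiction (offset-start (γ<a e′) (n<1+n k) o′ o) (<⇒≢ (γ<k e′))
  determines C B {e} {e′} _ _ (inj₂ (_ , o)) (inj₁ (_ , _ , _ , o′)) =
    contradiction (offset-start (γ<a e) (n<1+n k) o o′) (<⇒≢ (γ<k e))
  determines C B {e} {e′} _ _ (inj₂ (p , o)) (inj₂ (p′ , o′)) = by-target p p′ (offset-start (γ<a e) (γ<a e′) o o′)
  determines C C {e} {e′} _ _ (ke , j , o) (ke′ , j′ , o′) =
    same-goal ke ke′ (m<n⇒m<1+n (goalB< ke)) (m<n⇒m<1+n (goalB< ke′)) j j′ o o′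

  routeA : ∀ e → kind e ≡ A → Routed e
  routeA e ke with vertexV B (subst (γ e <_) (sym size-B) (γ<k e)) | goal e <? k
  routeA e ke | y , yB , yγ | yes g<k with offset-correct (γ<k e) g<k
  ... | o , σ<k with vertexU B (subst (_ <_) (sym size-B) σ<k)
  ...   | x , xB , xσ = detourOutside ke yB xB (λ ()) (refl , yγ) (ke , g<k , yγ , o′) (refl , o′)
    where
    o′ = subst (Offset k (γ e) (goal e)) (sym xσ) o
  -- The shift is k, the one residue modulo k + 1 that is not a colour, and it is applied to the
  -- rank γ of `y` instead of the target.
  routeA e ke | y , yB , yγ | no g≮k with offset-correct (n<1+n k) (γ<a e)
  ... | o , σ<a with vertexU C (subst (_ <_) (sym size-C) σ<a)
  ...   | x , xC , xσ = detourThrough ke yB xC (λ ()) y≢t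
    (refl , yγ)
    (inj₁ (ke , g≡k , yγ , subst (λ v → Offset (suc k) k v (rankU x)) (sym yγ) o′))
    (inj₁ (refl , g≡k , o′))
    where
    o′ = subst (Offset (suc k) k (γ e)) (sym xσ) o
    g≡k : goal e ≡ k
    g≡k = ≤-antisym (≤-pred (subst (goal e <_) size-A (goal< ke))) (≮⇒≥ g≮k)
    y≢t : y ≢ t e
    y≢t refl with trans (sym yB) ke
    ... | ()

  routeB : ∀ e → kind e ≡ B → Routed e
  routeB e ke with offset-correct (γ<a e) (m<n⇒m<1+n (goalB< ke))
  ... | o , σ<a with vertexV C (subst (γ e <_) (sym size-C) (γ<a e)) | vertexU C (subst (_ <_) (sym size-C) σ<a)
  ...   | y , yC , yγ | x , xC , xσ = detourOutside ke yC xC (λ ()) (refl , yγ) (ke , yγ , o′) (inj₂ (refl , o′))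
    where
    o′ = subst (Offset (suc k) (γ e) (goal e)) (sym xσ) o

  routeC : ∀ e → kind e ≡ C → Routed e
  routeC e ke with offset-correct (γ<a e) (goalC< ke)
  ... | o , σ<a with vertexV A (subst (γ e <_) (sym size-A) (γ<a e)) | vertexU A (subst (_ <_) (sym size-A) σ<a)
  ...   | y , yA , yγ | x , xA , xσ = detourOutside ke yA xA (λ ()) (inj₂ (refl , yγ)) (ke , yγ , o′) (refl , o′)
    where
    o′ = subst (Offset (suc k) (γ e) (goal e)) (sym xσ) o

  routed : ∀ e → Routed e
  routed e with kind e in ke
  ... | A = routeA e ke
  ... | B = routeB e ke
  ... | C = routeC e ke

  disjoint : EdgeDisjoint (λ e → proj₁ (routed e))
  disjoint = edgeDisjoint routed determines

-- Reduction of the theorem to the two patterns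

finColouring : ∀ {n m} k (s t : Fin m → Fin n) → AtMost _≟F_ k s (allFin m) → AtMost _≟F_ k t (allFin m) →
               Σ (Fin m → Fin k) λ c → (∀ {e e′} → s e ≡ s e′ → c e ≡ c e′ → e ≡ e′) ×
                                       (∀ {e e′} → t e ≡ t e′ → c e ≡ c e′ → e ≡ e′)
-- With no colours there is no demand, since a single one already violates the degree bound 0.
finColouring zero s t degS _ = empty , (λ {e} → contradiction′ e) , (λ {e} → contradiction′ e)
  where
  empty : Fin _ → Fin 0
  empty e = contradiction (λ _ _ → refl) (degS (λ _ → e) (λ _ → ∈-allFin e) λ { {zero} {zero} _ → refl })
  contradiction′ : ∀ {P : Set} → Fin _ → P
  contradiction′ e with empty e
  ... | ()
finColouring (suc k) s t degS degT with colouring _≟F_ _≟F_ _≟F_ k s t (allFin _) degS degT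
... | c , ps , pt = c , ps (∈-allFin _) (∈-allFin _) , pt (∈-allFin _) (∈-allFin _)

next : Fin 3 → Fin 3
next zero = suc zero
next (suc zero) = suc (suc zero)
next (suc (suc zero)) = zero

cyclic : Fin 3 → Class → Fin 3
cyclic i A = i
cyclic i B = next i
cyclic i C = next (next i)

cyclic⁻¹ : Fin 3 → Fin 3 → Class
cyclic⁻¹ zero zero = A
cyclic⁻¹ zero (suc zero) = B
cyclic⁻¹ zero (suc (suc zero)) = C
cyclic⁻¹ (suc zero) zero = C
cyclic⁻¹ (suc zero) (suc zero) = A
cyclic⁻¹ (suc zero) (suc (suc zero)) = B
cyclic⁻¹ (suc (suc zero)) zero = B
cyclic⁻¹ (suc (suc zero)) (suc zero) = C
cyclic⁻¹ (suc (suc zero)) (suc (suc zero)) = A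

cyclic-inverse : ∀ i j → cyclic i (cyclic⁻¹ i j) ≡ j
cyclic-inverse zero zero = refl
cyclic-inverse zero (suc zero) = refl
cyclic-inverse zero (suc (suc zero)) = refl
cyclic-inverse (suc zero) zero = refl
cyclic-inverse (suc zero) (suc zero) = refl
cyclic-inverse (suc zero) (suc (suc zero)) = refl
cyclic-inverse (suc (suc zero)) zero = refl
cyclic-inverse (suc (suc zero)) (suc zero) = refl
cyclic-inverse (suc (suc zero)) (suc (suc zero)) = refl

cyclic⁻¹-inverse : ∀ i κ → cyclic⁻¹ i (cyclic i κ) ≡ κ
cyclic⁻¹-inverse zero A = refl
cyclic⁻¹-inverse zero B = refl
cyclic⁻¹-inverse zero C = refl
cyclic⁻¹-inverse (suc zero) A = refl
cyclic⁻¹-inverse (suc zero) B = refl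
cyclic⁻¹-inverse (suc zero) C = refl
cyclic⁻¹-inverse (suc (suc zero)) A = refl
cyclic⁻¹-inverse (suc (suc zero)) B = refl
cyclic⁻¹-inverse (suc (suc zero)) C = refl

-- Both patterns place the only possible descent in size at the step from class i to the next. Two
-- positive excesses must both be 1, and counting then starts just before the class without excess.
data Shape (r : Fin 3 → ℕ) : Set where
  oneLarge : ∀ i → r i ≤ 2 → r (next i) ≡ 0 → r (next (next i)) ≡ 0 → Shape r
  oneSmall : ∀ i → r i ≡ 1 → r (next i) ≡ 0 → r (next (next i)) ≡ 1 → Shape r

shape : ∀ r → r zero + r (suc zero) + r (suc (suc zero)) ≤ 2 → Shape r
shape r sum with r zero in x | r (suc zero) in y | r (suc (suc zero)) in z
shape r sum | zero | zero | c = oneLarge (suc (suc zero)) (subst (_≤ 2) (sym z) sum) x y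
shape r sum | zero | suc b | zero = oneLarge (suc zero) (subst (_≤ 2) (trans (+-identityʳ _) (sym y)) sum) z x
shape r sum | zero | suc zero | suc zero = oneSmall (suc (suc zero)) z x y
shape r (s≤s (s≤s ())) | zero | suc zero | suc (suc c)
shape r (s≤s (s≤s p)) | zero | suc (suc b) | suc c = contradiction (≤-trans (m≤n+m (suc c) b) p) λ ()
shape r sum | suc a | zero | zero =
  oneLarge zero (subst (_≤ 2) (trans (trans (+-identityʳ _) (+-identityʳ _)) (sym x)) sum) y z
shape r sum | suc zero | zero | suc zero = oneSmall zero x y z
shape r (s≤s (s≤s ())) | suc zero | zero | suc (suc c)
shape r (s≤s (s≤s p)) | suc (suc a) | zero | suc c = contradiction (≤-trans (m≤n+m (suc c) _) p) λ ()
shape r sum | suc zero | suc zero | zero = oneSmall (suc zero) y z x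
shape r (s≤s (s≤s ())) | suc zero | suc zero | suc c
shape r (s≤s (s≤s ())) | suc zero | suc (suc b) | c
shape r (s≤s (s≤s p)) | suc (suc a) | suc b | c =
  contradiction (≤-trans (m≤n+m (suc b) a) (≤-trans (m≤m+n _ c) p)) λ ()

theorem2 : (n : ℕ) → 0 < n → (pU pV : Fin n → Fin 3) →
    (∀ i → classSize pU i ≡ classSize pV i) →
    (∀ i → n / 3 ≤ classSize pU i) →
    (D : List (Fin n × Fin n)) →
    MaxDegLe D (n / 3) →
    (∀ u v → (u , v) ∈ D → pU u ≡ pV v) →
    Resolvable (K n) (embedAll D)
theorem2 n _ pU pV balanced large D (degU≤ , degV≤) inside = byShape (shape excess excess≤2)
  where
  k = n / 3
  module U = Classes pU
  module V = Classes pV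
  source target : Fin (length D) → Fin n
  source e = proj₁ (lookup D e)
  target e = proj₂ (lookup D e)
  col = finColouring k source target (degree⇒AtMost _≟F_ proj₁ D degU≤) (degree⇒AtMost _≟F_ proj₂ D degV≤)

  excess : Fin 3 → ℕ
  excess i = classSize pU i ∸ k
  size≡ : ∀ i → classSize pU i ≡ k + excess i
  size≡ i = sym (m+[n∸m]≡n (large i))
  -- The sizes sum to n, so cancelling `k * 3` leaves n mod 3 as the sum of the excesses.
  excess≤2 : excess zero + excess (suc zero) + excess (suc (suc zero)) ≤ 2
  excess≤2 = ≤-trans (≤-reflexive (+-cancelʳ-≡ (k * 3) _ _ (trans (sym counted) (m≡m%n+[m/n]*n n 3))))
                     (≤-pred (m%n<n n 3))
    where
    regroup : ∀ k x y z → (k + x) + (k + y) + (k + z) ≡ x + y + z + k * 3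
    regroup = solve-∀
    counted : n ≡ excess zero + excess (suc zero) + excess (suc (suc zero)) + k * 3
    counted = trans (sym U.total) (trans (cong₂ _+_ (cong₂ _+_ (size≡ zero) (size≡ (suc zero))) (size≡ (suc (suc zero))))
                                         (regroup k (excess zero) (excess (suc zero)) (excess (suc (suc zero)))))

  demands : Fin 3 → Demands n (length D) k
  demands i = record
    { s = source ; t = target ; c = proj₁ col
    ; proper-s = proj₁ (proj₂ col) ; proper-t = proj₂ (proj₂ col)
    ; classU = cyclic⁻¹ i ∘ pU ; classV = cyclic⁻¹ i ∘ pV
    ; rankU = U.rankℕ ; rankV = V.rankℕ
    ; size = classSize pU ∘ cyclic i
    ; rankV<size = λ v → subst (V.rankℕ v <_) (trans (sym (balanced (pV v))) (cong (classSize pU) (sym (cyclic-inverse i (pV v)))))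
                               (toℕ<n (V.rank v refl))
    ; rankV-inj = λ {v} {v′} eq → V.rankℕ-injective
        (trans (sym (cyclic-inverse i (pV v))) (trans (cong (cyclic i) eq) (cyclic-inverse i (pV v′))))
    ; vertexU = λ κ j< → U.member (cyclic i κ) (fromℕ< j<) ,
        trans (cong (cyclic⁻¹ i) (U.member-class (cyclic i κ) _)) (cyclic⁻¹-inverse i κ) ,
        trans (U.rankℕ-member (cyclic i κ) _) (toℕ-fromℕ< j<)
    ; vertexV = λ κ j< → let j<′ = subst (_ <_) (balanced (cyclic i κ)) j< in V.member (cyclic i κ) (fromℕ< j<′) ,
        trans (cong (cyclic⁻¹ i) (V.member-class (cyclic i κ) _)) (cyclic⁻¹-inverse i κ) ,
        trans (V.rankℕ-member (cyclic i κ) _) (toℕ-fromℕ< j<′)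
    ; within = λ e → cong (cyclic⁻¹ i) (inside _ _ (∈-lookup e))
    }

  size-with : ∀ {j r} → excess j ≡ r → classSize pU j ≡ k + r
  size-with {j} refl = size≡ j

  byShape : Shape excess → Resolvable (K n) (embedAll D)
  byShape (oneLarge i r≤2 y≡0 z≡0) = resolvable D _ (OneLarge.disjoint (demands i) r≤2 (size≡ i)
    (trans (size-with y≡0) (+-identityʳ k)) (trans (size-with z≡0) (+-identityʳ k)))
  byShape (oneSmall i x≡1 y≡0 z≡1) = resolvable D _ (OneSmall.disjoint (demands i)
    (trans (size-with x≡1) (+-comm k 1)) (trans (size-with y≡0) (+-identityʳ k)) (trans (size-with z≡1) (+-comm k 1)))
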